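{- Let $\Psi$ be a $\mathsf{Max\text{ - }2OR}$ instance with $m_1$ 1-clauses and $m_2$ 2-clauses. Then $$\mathrm{val}_\Psi\ \le\ \min\left\{m_1+m_2,\ \frac{m_1+2m_2+\mathrm{bias}(\Psi)}{2}\right\}.$$
   Context: A $\mathsf{Max\text{ - }2OR}$ instance $\Psi$ consists of Boolean variables $x_1,\dots,x_n$ and a list of clauses, each being either a 1-clause (a single literal $x_i$ or $\neg x_i$) or a 2-clause (a disjunction of two literals of two distinct variables); clauses with two identical literals are regarded as 1-clauses, and there are no tautological clauses. $\mathrm{val}_\Psi$ is the maximum over all assignments of the number of satisfied clauses. For $r\in\{1,2\}$, $\mathrm{pos}^{(r)}_i(\Psi)$ and $\mathrm{neg}^{(r)}_i(\Psi)$ denote the numbers of $r$-clauses containing the literal $x_i$, respectively $\neg x_i$. The bias is $$\mathrm{bias}(\Psi)=\frac12\sum_{i=1}^n\left|2\,\mathrm{pos}^{(1)}_i(\Psi)+\mathrm{pos}^{(2)}_i(\Psi)-2\,\mathrm{neg}^{(1)}_i(\Psi)-\mathrm{neg}^{(2)}_i(\Psi)\right|.$$ -}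

module Defs where

open import Data.Bool.Base using (Bool; true; false; not; _∨_)
open import Data.Fin.Base using (Fin)
import Data.Fin.Properties as Fin
open import Data.Integer.Base using (+_; ∣_∣; _-_)
import Data.Integer.Base as ℤ
open import Data.List.Base
  using (List; []; _∷_; length; filter; filterᵇ; map; cartesianProductWith)
open import Data.List.Extrema.Nat using (max)
open import Data.List.Membership.Propositional using (_∈_)
open import Data.List.Membership.Propositional.Properties
  using (∈-cartesianProductWith⁺)
open import Data.List.Relation.Unary.Any using (here; there)
open import Data.Nat.Base using (ℕ; zero; suc)
import Data.Nat.Properties as ℕ
open import Data.Rational.Base using (ℚ; ½; _*_; _/_)
open import Data.Vec.Base as Vec using (Vec; lookup)
open import Relation.Binary.Definitions using (DecidableEquality)
open import Relation.Binary.PropositionalEquality using (_≡_; _≢_; refl; cong)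
open import Relation.Nullary.Decidable using (yes; no; map′; _×-dec_)

open import Algebra.Properties.CommutativeMonoid.Sum ℕ.+-0-commutativeMonoid
  using (sum-syntax)

data Literal (n : ℕ) : Set where
  pos neg : Fin n → Literal n

var : ∀ {n} → Literal n → Fin n
var (pos i) = i
var (neg i) = i

_≟_ : ∀ {n} → DecidableEquality (Literal n)
pos i ≟ pos j = map′ (cong pos) (λ { refl → refl }) (i Fin.≟ j)
pos i ≟ neg j = no λ ()
neg i ≟ pos j = no λ ()
neg i ≟ neg j = map′ (cong neg) (λ { refl → refl }) (i Fin.≟ j)

-- The distinctness condition rules out both ℓ ∨ ℓ (which is the 1-clause ℓ)
-- and tautologies.
data Clause (n : ℕ) : Set where
  clause₁ : Literal n → Clause n
  clause₂ : (ℓ ℓ′ : Literal n) → var ℓ ≢ var ℓ′ → Clause n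

-- A list, so repeated clauses count with multiplicity.
Max2OR : ℕ → Set
Max2OR n = List (Clause n)

literals : ∀ {n} → Clause n → List (Literal n)
literals (clause₁ ℓ)      = ℓ ∷ []
literals (clause₂ ℓ ℓ′ _) = ℓ ∷ ℓ′ ∷ []

width : ∀ {n} → Clause n → ℕ
width c = length (literals c)

Assignment : ℕ → Set
Assignment = Vec Bool

evalLiteral : ∀ {n} → Assignment n → Literal n → Bool
evalLiteral a (pos i) = lookup a i
evalLiteral a (neg i) = not (lookup a i)

evalClause : ∀ {n} → Assignment n → Clause n → Bool
evalClause a (clause₁ ℓ)      = evalLiteral a ℓ
evalClause a (clause₂ ℓ ℓ′ _) = evalLiteral a ℓ ∨ evalLiteral a ℓ′

numSatisfied : ∀ {n} → Max2OR n → Assignment n → ℕ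
numSatisfied Ψ a = length (filterᵇ (evalClause a) Ψ)

assignments : ∀ n → List (Assignment n)
assignments zero    = Vec.[] ∷ []
assignments (suc n) =
  cartesianProductWith Vec._∷_ (true ∷ false ∷ []) (assignments n)

assignments-complete : ∀ {n} (a : Assignment n) → a ∈ assignments n
assignments-complete Vec.[] = here refl
assignments-complete (b Vec.∷ a) =
  ∈-cartesianProductWith⁺ Vec._∷_ (bool∈ b) (assignments-complete a)
  where
  bool∈ : ∀ b → b ∈ true ∷ false ∷ []
  bool∈ true  = here refl
  bool∈ false = there (here refl)

-- The base value 0 is harmless: the list of assignments is never empty and
-- every count is at least 0.
val : ∀ {n} → Max2OR n → ℕ
val {n} Ψ = max 0 (map (numSatisfied Ψ) (assignments n))

numClauses : ∀ {n} → ℕ → Max2OR n → ℕ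
numClauses r Ψ = length (filter (λ c → width c ℕ.≟ r) Ψ)

-- occurrences r (pos i) Ψ is pos⁽ʳ⁾ᵢ(Ψ), and occurrences r (neg i) Ψ is
-- neg⁽ʳ⁾ᵢ(Ψ).
occurrences : ∀ {n} → ℕ → Literal n → Max2OR n → ℕ
occurrences r ℓ Ψ =
  length (filter (λ c → (width c ℕ.≟ r) ×-dec (ℓ ∈? literals c)) Ψ)
  where open import Data.List.Membership.DecPropositional _≟_ using (_∈?_)

fromℕ : ℕ → ℚ
fromℕ k = + k / 1

bias : ∀ {n} → Max2OR n → ℚ
bias {n} Ψ = ½ * fromℕ (∑[ i < n ]
  ∣ + 2 ℤ.* + occurrences 1 (pos i) Ψ ℤ.+ + occurrences 2 (pos i) Ψ
    - + 2 ℤ.* + occurrences 1 (neg i) Ψ - + occurrences 2 (neg i) Ψ ∣)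

{-# OPTIONS --safe #-}

-- Give the literal of a clause weight 2 in a 1-clause and 1 in each place of a
-- 2-clause.  Under an assignment a, let T and F be the total weights of the
-- true and of the false literal occurrences.  Clause by clause,
-- 4 [satisfied] + F ≤ 2 [1-clause] + 4 [2-clause] + T.  Grouped by variables,
-- T - F is a signed sum of the terms whose absolute values add up to 2 bias(Ψ),
-- whence 4 val ≤ 2 m₁ + 4 m₂ + 2 bias(Ψ).
module Submission where

open import Defs
open import Data.Nat.Base using (ℕ) renaming (_+_ to _+ℕ_)
open import Data.Rational.Base using (_≤_; _⊓_; _+_; _*_; ½)
open import Relation.Binary.PropositionalEquality using (_≡_)

open import Data.Bool.Base using (Bool; true; false; not; if_then_else_)
open import Data.Fin.Base using (Fin; zero; suc; punchIn)
open import Data.Fin.Properties using (punchInᵢ≢i)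
open import Data.Integer.Base using (+_; ∣_∣)
import Data.Integer.Base as ℤ
import Data.Integer.Properties as ℤ
open import Data.Integer.Solver using () renaming (module +-*-Solver to ℤ-Solver)
open import Data.List.Base using (List; []; _∷_; length; filterᵇ)
open import Data.List.Extrema.Nat using (argmax-all)
open import Data.List.Properties using (length-filter)
import Data.List.Relation.Unary.All as All
import Data.List.Relation.Unary.All.Properties as All
open import Data.Nat.Base as ℕ using (z≤n)
import Data.Nat.Properties as ℕ
open import Data.Nat.Solver using () renaming (module +-*-Solver to ℕ-Solver)
open import Data.Rational.Base using (toℚᵘ)
import Data.Rational.Properties as ℚ
open import Data.Rational.Solver using () renaming (module +-*-Solver to ℚ-Solver)
open import Data.Rational.Unnormalised.Base using (mkℚᵘ; *≤*; *≡*)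
import Data.Rational.Unnormalised.Base as ℚᵘ
import Data.Rational.Unnormalised.Properties as ℚᵘ
open import Data.Vec.Base using (lookup)
open import Function.Base using (_∘_; id)
open import Relation.Binary.PropositionalEquality
  using (_≢_; refl; sym; trans; cong; cong₂; subst; module ≡-Reasoning)
open import Relation.Nullary.Decidable using (yes; no; does; dec-true; dec-false; T?)
open import Relation.Nullary.Negation using (contradiction)

open import Algebra.Properties.CommutativeMonoid.Sum ℕ.+-0-commutativeMonoid
  using (sum; sum-syntax; sum-remove; sum-cong-≗; sum-replicate-zero; ∑-distrib-+)

private variable
  n : ℕ

-- Finite sums and indicators

∑-single : (f : Fin n → ℕ) (i : Fin n) → (∀ j → j ≢ i → f j ≡ 0) → sum f ≡ f i
∑-single {ℕ.suc n} f i f≡0 = begin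
  sum f                            ≡⟨ sum-remove {i = i} f ⟩
  f i ℕ.+ sum (f ∘ punchIn i)      ≡⟨ cong (f i ℕ.+_) (sum-cong-≗ λ j → f≡0 _ (punchInᵢ≢i i j)) ⟩
  f i ℕ.+ ∑[ j < n ] 0             ≡⟨ cong (f i ℕ.+_) (sum-replicate-zero n) ⟩
  f i ℕ.+ 0                        ≡⟨ ℕ.+-identityʳ _ ⟩
  f i                              ∎
  where open ≡-Reasoning

∑-mono-≤ : (f g : Fin n → ℕ) → (∀ i → f i ℕ.≤ g i) → sum f ℕ.≤ sum g
∑-mono-≤ {ℕ.zero}  f g f≤g = z≤n
∑-mono-≤ {ℕ.suc n} f g f≤g =
  ℕ.+-mono-≤ (f≤g zero) (∑-mono-≤ (f ∘ suc) (g ∘ suc) (f≤g ∘ suc))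

indicator : Bool → ℕ
indicator b = if b then 1 else 0

length-filterᵇ-∷ : ∀ {A : Set} (p : A → Bool) x xs →
  length (filterᵇ p (x ∷ xs)) ≡ indicator (p x) ℕ.+ length (filterᵇ p xs)
length-filterᵇ-∷ p x xs with p x
... | true  = refl
... | false = refl

-- Literals chosen by an assignment

δ : Literal n → Literal n → ℕ
δ ℓ ℓ′ = indicator (does (ℓ ≟ ℓ′))

-- The literal of `i` that `β` makes true. Taking `β` as a function lets `not ∘ β` select the false
-- literals, so T and F are one sum evaluated at `β` and at its complement.
literalOf : (Fin n → Bool) → Fin n → Literal n
literalOf β i = if β i then pos i else neg i

holds : (Fin n → Bool) → Literal n → Bool
holds β (pos i) = β i
holds β (neg i) = not (β i)

var-literalOf : (β : Fin n → Bool) (i : Fin n) → var (literalOf β i) ≡ i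
var-literalOf β i with β i
... | true  = refl
... | false = refl

δ-literalOf-var : (β : Fin n → Bool) (ℓ : Literal n) →
  δ (literalOf β (var ℓ)) ℓ ≡ indicator (holds β ℓ)
δ-literalOf-var β (pos i) with β i
... | true  = cong indicator (dec-true (pos i ≟ pos i) refl)
... | false = refl
δ-literalOf-var β (neg i) with β i
... | true  = refl
... | false = cong indicator (dec-true (neg i ≟ neg i) refl)

-- The literal chosen at `j` has variable `j`, so only `j = var ℓ` can contribute, and it does
-- exactly when `ℓ` is true. This turns sums over variables into truth values inside a clause.
∑-δ-literalOf : (β : Fin n → Bool) (ℓ : Literal n) →
  ∑[ i < n ] δ (literalOf β i) ℓ ≡ indicator (holds β ℓ)
∑-δ-literalOf β ℓ = trans
  (∑-single (λ i → δ (literalOf β i) ℓ) (var ℓ) λ j j≢ →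
    cong indicator (dec-false (literalOf β j ≟ ℓ)
      λ eq → j≢ (trans (sym (var-literalOf β j)) (cong var eq))))
  (δ-literalOf-var β ℓ)

-- Weights, grouped by literal and by clause

weight : Literal n → Max2OR n → ℕ
weight ℓ Ψ = 2 ℕ.* occurrences 1 ℓ Ψ ℕ.+ occurrences 2 ℓ Ψ

-- The doubled `δ` of a 1-clause is written as a sum, so that `∑-distrib-+` treats both kinds of
-- clause alike.
clauseWeight : Literal n → Clause n → ℕ
clauseWeight ℓ (clause₁ ℓ₁)      = δ ℓ ℓ₁ ℕ.+ δ ℓ ℓ₁
clauseWeight ℓ (clause₂ ℓ₁ ℓ₂ _) = δ ℓ ℓ₁ ℕ.+ δ ℓ ℓ₂

weight-∷ : (ℓ : Literal n) (c : Clause n) (Ψ : Max2OR n) →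
  weight ℓ (c ∷ Ψ) ≡ clauseWeight ℓ c ℕ.+ weight ℓ Ψ
weight-∷ ℓ (clause₁ ℓ₁) Ψ with ℓ ≟ ℓ₁
... | yes _ = cong (ℕ._+ occurrences 2 ℓ Ψ) (ℕ.*-suc 2 (occurrences 1 ℓ Ψ))
... | no  _ = refl
weight-∷ ℓ (clause₂ ℓ₁ ℓ₂ ℓ₁≢ℓ₂) Ψ with ℓ ≟ ℓ₁ | ℓ ≟ ℓ₂
-- Here `occurrences` would count the clause once but `clauseWeight` would count two places;
-- distinctness of the variables excludes the case.
... | yes ℓ≡ℓ₁ | yes ℓ≡ℓ₂ =
  contradiction (cong var (trans (sym ℓ≡ℓ₁) ℓ≡ℓ₂)) ℓ₁≢ℓ₂
... | yes _    | no _     = ℕ.+-suc (2 ℕ.* occurrences 1 ℓ Ψ) (occurrences 2 ℓ Ψ)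
... | no _     | yes _    = ℕ.+-suc (2 ℕ.* occurrences 1 ℓ Ψ) (occurrences 2 ℓ Ψ)
... | no _     | no _     = refl

totalWeight : (Fin n → Bool) → Max2OR n → ℕ
totalWeight {n} β Ψ = ∑[ i < n ] weight (literalOf β i) Ψ

clauseTotal : (Fin n → Bool) → Clause n → ℕ
clauseTotal β (clause₁ ℓ)      = indicator (holds β ℓ) ℕ.+ indicator (holds β ℓ)
clauseTotal β (clause₂ ℓ ℓ′ _) = indicator (holds β ℓ) ℕ.+ indicator (holds β ℓ′)

∑-clauseWeight : (β : Fin n → Bool) (c : Clause n) →
  ∑[ i < n ] clauseWeight (literalOf β i) c ≡ clauseTotal β c
∑-clauseWeight β (clause₁ ℓ) = trans
  (∑-distrib-+ (λ i → δ (literalOf β i) ℓ) (λ i → δ (literalOf β i) ℓ))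
  (cong₂ ℕ._+_ (∑-δ-literalOf β ℓ) (∑-δ-literalOf β ℓ))
∑-clauseWeight β (clause₂ ℓ ℓ′ _) = trans
  (∑-distrib-+ (λ i → δ (literalOf β i) ℓ) (λ i → δ (literalOf β i) ℓ′))
  (cong₂ ℕ._+_ (∑-δ-literalOf β ℓ) (∑-δ-literalOf β ℓ′))

totalWeight-[] : (β : Fin n → Bool) → totalWeight β [] ≡ 0
totalWeight-[] {n} β = sum-replicate-zero n

totalWeight-∷ : (β : Fin n → Bool) (c : Clause n) (Ψ : Max2OR n) →
  totalWeight β (c ∷ Ψ) ≡ clauseTotal β c ℕ.+ totalWeight β Ψ
totalWeight-∷ {n} β c Ψ = begin
  totalWeight β (c ∷ Ψ)
    ≡⟨ sum-cong-≗ (λ i → weight-∷ (literalOf β i) c Ψ) ⟩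
  ∑[ i < n ] (clauseWeight (literalOf β i) c ℕ.+ weight (literalOf β i) Ψ)
    ≡⟨ ∑-distrib-+ (λ i → clauseWeight (literalOf β i) c) (λ i → weight (literalOf β i) Ψ) ⟩
  ∑[ i < n ] clauseWeight (literalOf β i) c ℕ.+ totalWeight β Ψ
    ≡⟨ cong (ℕ._+ totalWeight β Ψ) (∑-clauseWeight β c) ⟩
  clauseTotal β c ℕ.+ totalWeight β Ψ ∎
  where open ≡-Reasoning

-- The clausewise inequality

budget : Max2OR n → ℕ
budget Ψ = 2 ℕ.* numClauses 1 Ψ ℕ.+ 4 ℕ.* numClauses 2 Ψ

clauseBudget : Clause n → ℕ
clauseBudget (clause₁ _)     = 2
clauseBudget (clause₂ _ _ _) = 4

budget-∷ : (c : Clause n) (Ψ : Max2OR n) →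
  budget (c ∷ Ψ) ≡ clauseBudget c ℕ.+ budget Ψ
budget-∷ (clause₁ _) Ψ =
  solve 2 (λ x y → con 2 :* (con 1 :+ x) :+ con 4 :* y
                := con 2 :+ (con 2 :* x :+ con 4 :* y)) refl
    (numClauses 1 Ψ) (numClauses 2 Ψ)
  where open ℕ-Solver
budget-∷ (clause₂ _ _ _) Ψ =
  solve 2 (λ x y → con 2 :* x :+ con 4 :* (con 1 :+ y)
                := con 4 :+ (con 2 :* x :+ con 4 :* y)) refl
    (numClauses 1 Ψ) (numClauses 2 Ψ)
  where open ℕ-Solver

holds-lookup : (a : Assignment n) (ℓ : Literal n) → holds (lookup a) ℓ ≡ evalLiteral a ℓ
holds-lookup a (pos i) = refl
holds-lookup a (neg i) = refl

holds-not : (β : Fin n → Bool) (ℓ : Literal n) → holds (not ∘ β) ℓ ≡ not (holds β ℓ)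
holds-not β (pos i) = refl
holds-not β (neg i) = refl

-- The false weight stands on the left to avoid subtraction in ℕ. Equality holds for every 1-clause
-- and for a 2-clause with one true literal; a 2-clause whose literals have equal truth values
-- leaves slack 2.
clause-bound : (a : Assignment n) (c : Clause n) →
  4 ℕ.* indicator (evalClause a c) ℕ.+ clauseTotal (not ∘ lookup a) c
    ℕ.≤ clauseBudget c ℕ.+ clauseTotal (lookup a) c
clause-bound a (clause₁ ℓ)
  rewrite holds-not (lookup a) ℓ | holds-lookup a ℓ
  with evalLiteral a ℓ
... | true  = ℕ.≤-refl
... | false = ℕ.≤-refl
clause-bound a (clause₂ ℓ ℓ′ _)
  rewrite holds-not (lookup a) ℓ | holds-lookup a ℓ
        | holds-not (lookup a) ℓ′ | holds-lookup a ℓ′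
  with evalLiteral a ℓ | evalLiteral a ℓ′
... | true  | true  = ℕ.m≤m+n 4 2
... | true  | false = ℕ.≤-refl
... | false | true  = ℕ.≤-refl
... | false | false = ℕ.m≤m+n 2 2

satisfied-bound : (Ψ : Max2OR n) (a : Assignment n) →
  4 ℕ.* numSatisfied Ψ a ℕ.+ totalWeight (not ∘ lookup a) Ψ
    ℕ.≤ budget Ψ ℕ.+ totalWeight (lookup a) Ψ
satisfied-bound [] a
  rewrite totalWeight-[] (not ∘ lookup a) = z≤n
satisfied-bound (c ∷ Ψ) a
  rewrite length-filterᵇ-∷ (evalClause a) c Ψ | budget-∷ c Ψ
        | totalWeight-∷ (not ∘ lookup a) c Ψ | totalWeight-∷ (lookup a) c Ψ
  = begin
  4 ℕ.* (s ℕ.+ S) ℕ.+ (f ℕ.+ F)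
    ≡⟨ solve 4 (λ s S f F → con 4 :* (s :+ S) :+ (f :+ F)
                         := (con 4 :* s :+ f) :+ (con 4 :* S :+ F)) refl s S f F ⟩
  (4 ℕ.* s ℕ.+ f) ℕ.+ (4 ℕ.* S ℕ.+ F)
    ≤⟨ ℕ.+-mono-≤ (clause-bound a c) (satisfied-bound Ψ a) ⟩
  (b ℕ.+ t) ℕ.+ (B ℕ.+ T)
    ≡⟨ solve 4 (λ b t B T → (b :+ t) :+ (B :+ T) := (b :+ B) :+ (t :+ T)) refl b t B T ⟩
  (b ℕ.+ B) ℕ.+ (t ℕ.+ T) ∎
  where
  open ℕ.≤-Reasoning
  open ℕ-Solver
  s = indicator (evalClause a c)
  S = numSatisfied Ψ a
  f = clauseTotal (not ∘ lookup a) c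
  F = totalWeight (not ∘ lookup a) Ψ
  b = clauseBudget c
  B = budget Ψ
  t = clauseTotal (lookup a) c
  T = totalWeight (lookup a) Ψ

-- Imbalance of the two literals of a variable

imbalance : Max2OR n → Fin n → ℕ
imbalance Ψ i =
  ∣ + 2 ℤ.* + occurrences 1 (pos i) Ψ ℤ.+ + occurrences 2 (pos i) Ψ
    ℤ.- + 2 ℤ.* + occurrences 1 (neg i) Ψ ℤ.- + occurrences 2 (neg i) Ψ ∣

imbalance≡∣-∣ : (Ψ : Max2OR n) (i : Fin n) →
  imbalance Ψ i ≡ ∣ + weight (pos i) Ψ ℤ.- + weight (neg i) Ψ ∣
imbalance≡∣-∣ Ψ i = cong ∣_∣ (begin
  + 2 ℤ.* + p ℤ.+ + q ℤ.- + 2 ℤ.* + r ℤ.- + s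
    ≡⟨ solve 4 (λ p q r s → con (+ 2) :* p :+ q :- con (+ 2) :* r :- s
                         := (con (+ 2) :* p :+ q) :- (con (+ 2) :* r :+ s))
         refl (+ p) (+ q) (+ r) (+ s) ⟩
  (+ 2 ℤ.* + p ℤ.+ + q) ℤ.- (+ 2 ℤ.* + r ℤ.+ + s)
    -- Sums of nonnegative integers compute to sums in ℕ, so only the two products need converting.
    ≡⟨ cong₂ (λ x y → (x ℤ.+ + q) ℤ.- (y ℤ.+ + s)) (ℤ.pos-* 2 p) (ℤ.pos-* 2 r) ⟨
  + (2 ℕ.* p ℕ.+ q) ℤ.- + (2 ℕ.* r ℕ.+ s) ∎)
  where
  open ≡-Reasoning
  open ℤ-Solver
  p = occurrences 1 (pos i) Ψ
  q = occurrences 2 (pos i) Ψ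
  r = occurrences 1 (neg i) Ψ
  s = occurrences 2 (neg i) Ψ

-- The triangle inequality applied to m = n + (m - n).
m≤n+∣m-n∣ : ∀ m n → m ℕ.≤ n ℕ.+ ∣ + m ℤ.- + n ∣
m≤n+∣m-n∣ m n = subst (λ k → ∣ k ∣ ℕ.≤ n ℕ.+ ∣ + m ℤ.- + n ∣)
  (solve 2 (λ i j → j :+ (i :- j) := i) refl (+ m) (+ n))
  (ℤ.∣i+j∣≤∣i∣+∣j∣ (+ n) (+ m ℤ.- + n))
  where open ℤ-Solver

-- The absolute value is symmetric in the two literals, so it bounds the excess of whichever one `β`
-- makes true.
literal-imbalance : (β : Fin n → Bool) (Ψ : Max2OR n) (i : Fin n) →
  weight (literalOf β i) Ψ ℕ.≤ weight (literalOf (not ∘ β) i) Ψ ℕ.+ imbalance Ψ i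
literal-imbalance β Ψ i rewrite imbalance≡∣-∣ Ψ i with β i
... | true  = m≤n+∣m-n∣ (weight (pos i) Ψ) (weight (neg i) Ψ)
... | false rewrite ℤ.∣i-j∣≡∣j-i∣ (+ weight (pos i) Ψ) (+ weight (neg i) Ψ) =
  m≤n+∣m-n∣ (weight (neg i) Ψ) (weight (pos i) Ψ)

totalWeight-imbalance : (β : Fin n → Bool) (Ψ : Max2OR n) →
  totalWeight β Ψ ℕ.≤ totalWeight (not ∘ β) Ψ ℕ.+ sum (imbalance Ψ)
totalWeight-imbalance β Ψ = ℕ.≤-trans
  (∑-mono-≤ _ _ (literal-imbalance β Ψ))
  (ℕ.≤-reflexive (∑-distrib-+ (λ i → weight (literalOf (not ∘ β) i) Ψ) (imbalance Ψ)))

-- Bounding the true weight by the false weight plus the total imbalance puts `F` on both sides,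
-- where it cancels.
4*numSatisfied≤ : (Ψ : Max2OR n) (a : Assignment n) →
  4 ℕ.* numSatisfied Ψ a ℕ.≤ budget Ψ ℕ.+ sum (imbalance Ψ)
4*numSatisfied≤ Ψ a = ℕ.+-cancelʳ-≤ F _ _ (begin
  4 ℕ.* numSatisfied Ψ a ℕ.+ F              ≤⟨ satisfied-bound Ψ a ⟩
  budget Ψ ℕ.+ totalWeight (lookup a) Ψ     ≤⟨ ℕ.+-monoʳ-≤ (budget Ψ) (totalWeight-imbalance (lookup a) Ψ) ⟩
  budget Ψ ℕ.+ (F ℕ.+ I)                    ≡⟨ cong (budget Ψ ℕ.+_) (ℕ.+-comm F I) ⟩
  budget Ψ ℕ.+ (I ℕ.+ F)                    ≡⟨ ℕ.+-assoc (budget Ψ) I F ⟨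
  (budget Ψ ℕ.+ I) ℕ.+ F                    ∎)
  where
  open ℕ.≤-Reasoning
  F = totalWeight (not ∘ lookup a) Ψ
  I = sum (imbalance Ψ)

-- Bounds on the value

val-all : (P : ℕ → Set) (Ψ : Max2OR n) → P 0 → (∀ a → P (numSatisfied Ψ a)) → P (val Ψ)
val-all {n} P Ψ P0 Pa =
  -- The maximum is either its base value 0 or the count of some assignment; `P0` covers the former.
  argmax-all id {P = P} P0 (All.map⁺ (All.universal Pa (assignments n)))

length≡numClauses : (Ψ : Max2OR n) → length Ψ ≡ numClauses 1 Ψ ℕ.+ numClauses 2 Ψ
length≡numClauses []                  = refl
length≡numClauses (clause₁ _ ∷ Ψ)     = cong ℕ.suc (length≡numClauses Ψ)
length≡numClauses (clause₂ _ _ _ ∷ Ψ) =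
  trans (cong ℕ.suc (length≡numClauses Ψ)) (sym (ℕ.+-suc (numClauses 1 Ψ) _))

val≤ : (Ψ : Max2OR n) → val Ψ ℕ.≤ numClauses 1 Ψ ℕ.+ numClauses 2 Ψ
val≤ Ψ = subst (val Ψ ℕ.≤_) (length≡numClauses Ψ)
  (val-all (ℕ._≤ length Ψ) Ψ z≤n λ a → length-filter (T? ∘ evalClause a) Ψ)

4*val≤ : (Ψ : Max2OR n) → 4 ℕ.* val Ψ ℕ.≤ budget Ψ ℕ.+ sum (imbalance Ψ)
4*val≤ Ψ = val-all (λ v → 4 ℕ.* v ℕ.≤ budget Ψ ℕ.+ sum (imbalance Ψ)) Ψ z≤n (4*numSatisfied≤ Ψ)

-- Transfer to the rationals

toℚᵘ-fromℕ : ∀ k → toℚᵘ (fromℕ k) ℚᵘ.≃ mkℚᵘ (+ k) 0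
-- `fromℕ k` is normalised through a gcd and does not compute for variable `k`, so order and
-- arithmetic are checked on the unnormalised k/1. The 0 is the denominator minus one.
toℚᵘ-fromℕ k = ℚ.toℚᵘ-fromℚᵘ (mkℚᵘ (+ k) 0)

fromℕ-mono-≤ : ∀ {j k} → j ℕ.≤ k → fromℕ j ≤ fromℕ k
fromℕ-mono-≤ {j} {k} j≤k = ℚ.toℚᵘ-cancel-≤ (begin
  toℚᵘ (fromℕ j)   ≃⟨ toℚᵘ-fromℕ j ⟩
  mkℚᵘ (+ j) 0     ≤⟨ *≤* (ℤ.*-monoʳ-≤-nonNeg (+ 1) (ℤ.+≤+ j≤k)) ⟩
  mkℚᵘ (+ k) 0     ≃⟨ toℚᵘ-fromℕ k ⟨
  toℚᵘ (fromℕ k)   ∎)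
  where open ℚᵘ.≤-Reasoning

fromℕ-+ : ∀ j k → fromℕ (j ℕ.+ k) ≡ fromℕ j + fromℕ k
fromℕ-+ j k = ℚ.toℚᵘ-injective (begin
  toℚᵘ (fromℕ (j ℕ.+ k))                 ≈⟨ toℚᵘ-fromℕ (j ℕ.+ k) ⟩
  mkℚᵘ (+ (j ℕ.+ k)) 0                   ≈⟨ *≡* (cong (ℤ._* + 1) (cong₂ ℤ._+_ (ℤ.*-identityʳ (+ j)) (ℤ.*-identityʳ (+ k)))) ⟨
  mkℚᵘ (+ j) 0 ℚᵘ.+ mkℚᵘ (+ k) 0         ≈⟨ ℚᵘ.+-cong (toℚᵘ-fromℕ j) (toℚᵘ-fromℕ k) ⟨
  toℚᵘ (fromℕ j) ℚᵘ.+ toℚᵘ (fromℕ k)     ≈⟨ ℚ.toℚᵘ-homo-+ (fromℕ j) (fromℕ k) ⟨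
  toℚᵘ (fromℕ j + fromℕ k)               ∎)
  where open ℚᵘ.≃-Reasoning

fromℕ-* : ∀ j k → fromℕ (j ℕ.* k) ≡ fromℕ j * fromℕ k
fromℕ-* j k = ℚ.toℚᵘ-injective (begin
  toℚᵘ (fromℕ (j ℕ.* k))                 ≈⟨ toℚᵘ-fromℕ (j ℕ.* k) ⟩
  mkℚᵘ (+ (j ℕ.* k)) 0                   ≈⟨ *≡* (cong (ℤ._* + 1) (ℤ.pos-* j k)) ⟩
  mkℚᵘ (+ j) 0 ℚᵘ.* mkℚᵘ (+ k) 0         ≈⟨ ℚᵘ.*-cong (toℚᵘ-fromℕ j) (toℚᵘ-fromℕ k) ⟨
  toℚᵘ (fromℕ j) ℚᵘ.* toℚᵘ (fromℕ k)     ≈⟨ ℚ.toℚᵘ-homo-* (fromℕ j) (fromℕ k) ⟨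
  toℚᵘ (fromℕ j * fromℕ k)               ∎)
  where open ℚᵘ.≃-Reasoning

-- The factor 4 clears both the outer `½` and the `½` in front of `s`, which is why all the counting
-- was done for four times the value.
fromℕ-bound : ∀ v m₁ m₂ s → 4 ℕ.* v ℕ.≤ (2 ℕ.* m₁ ℕ.+ 4 ℕ.* m₂) ℕ.+ s →
  fromℕ v ≤ ½ * (fromℕ m₁ + fromℕ 2 * fromℕ m₂ + ½ * fromℕ s)
fromℕ-bound v m₁ m₂ s 4v≤ = ℚ.*-cancelˡ-≤-pos (fromℕ 4) (begin
  fromℕ 4 * fromℕ v
    ≡⟨ fromℕ-* 4 v ⟨
  fromℕ (4 ℕ.* v)
    ≤⟨ fromℕ-mono-≤ 4v≤ ⟩
  fromℕ ((2 ℕ.* m₁ ℕ.+ 4 ℕ.* m₂) ℕ.+ s)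
    ≡⟨ trans (fromℕ-+ (2 ℕ.* m₁ ℕ.+ 4 ℕ.* m₂) s) (cong (_+ fromℕ s) (fromℕ-+ (2 ℕ.* m₁) (4 ℕ.* m₂))) ⟩
  fromℕ (2 ℕ.* m₁) + fromℕ (4 ℕ.* m₂) + fromℕ s
    ≡⟨ cong₂ (λ x y → x + y + fromℕ s) (fromℕ-* 2 m₁) (fromℕ-* 4 m₂) ⟩
  fromℕ 2 * fromℕ m₁ + fromℕ 4 * fromℕ m₂ + fromℕ s
    ≡⟨ solve 3 (λ x y z → con (fromℕ 2) :* x :+ con (fromℕ 4) :* y :+ z
         := con (fromℕ 4) :* (con ½ :* (x :+ con (fromℕ 2) :* y :+ con ½ :* z)))
         refl (fromℕ m₁) (fromℕ m₂) (fromℕ s) ⟩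
  fromℕ 4 * (½ * (fromℕ m₁ + fromℕ 2 * fromℕ m₂ + ½ * fromℕ s)) ∎)
  where
  open ℚ.≤-Reasoning
  open ℚ-Solver

lemma3p6 : ∀ {n : ℕ} (Ψ : Max2OR n) (m₁ m₂ : ℕ) →
    numClauses 1 Ψ ≡ m₁ → numClauses 2 Ψ ≡ m₂ →
    fromℕ (val Ψ) ≤
    fromℕ (m₁ +ℕ m₂) ⊓ (½ * (fromℕ m₁ + fromℕ 2 * fromℕ m₂ + bias Ψ))
lemma3p6 Ψ m₁ m₂ refl refl = ℚ.⊓-glb
  (fromℕ-mono-≤ (val≤ Ψ))
  -- `imbalance` repeats the summand of `bias`, so `bias Ψ` unfolds to
  -- `½ * fromℕ (sum (imbalance Ψ))`.
  (fromℕ-bound (val Ψ) m₁ m₂ (sum (imbalance Ψ)) (4*val≤ Ψ))
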